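{- Let $r\geq 1$ and $k\geq r-1$ be integers. Then there exists an integer $n_0(k,r)$ such that for every $n\geq n_0(k,r)$, $W(n,k,r)=\binom{n-k+r-1}{r-1}$.
   Context: For a positive integer $n$, $[n]=\{1,2,\ldots,n\}$, and $[n]^{(k)}$ denotes the family of all $k$-element subsets of $[n]$. The trace of a family $\mathcal{A}$ of sets on a set $X$ is $\mathcal{A}|_X=\{A\cap X: A\in\mathcal{A}\}$. For a set $X$ with $|X|=r$, a maximal chain of $X$ is a family $\{X_0,X_1,\ldots,X_r\}$ of subsets of $X$ with $X_0\subset X_1\subset\cdots\subset X_r=X$ and $|X_i|=i$ for all $i$; the trace $\mathcal{A}|_X$ contains a maximal chain of $X$ if every member of such a chain belongs to $\mathcal{A}|_X$. For $n\geq k$ and $r\geq 1$, $W(n,k,r)$ is the maximum size of a family $\mathcal{A}\subseteq[n]^{(k)}$ such that for every $r$-element subset $X$ of $[n]$ the trace $\mathcal{A}|_X$ does not contain a maximal chain of $X$. -}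

module Defs where

open import Data.Nat using (ℕ; _≤_; _∸_; _+_)
open import Data.Fin using (Fin; toℕ; inject₁; fromℕ) renaming (suc to fsuc)
open import Data.Fin.Subset using (Subset; _⊆_; _∩_; ∣_∣)
open import Data.List using (List; length)
open import Data.List.Membership.Propositional using (_∈_)
open import Data.List.Relation.Unary.All using (All)
open import Data.List.Relation.Unary.Unique.Propositional using (Unique)
open import Data.Product using (Σ; _×_; ∃-syntax)
open import Relation.Binary.PropositionalEquality using (_≡_)
open import Relation.Nullary using (¬_)

-- A family of subsets of [n] (elements encoded as Fin n), given as a
-- duplicate-free list; its size is the length of the list.
Family : ℕ → Set
Family n = List (Subset n)

IsKFamily : ∀ {n} → ℕ → Family n → Set
IsKFamily k 𝒜 = Unique 𝒜 × All (λ A → ∣ A ∣ ≡ k) 𝒜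

InTrace : ∀ {n} → Family n → Subset n → Subset n → Set
InTrace 𝒜 X Y = ∃[ A ] (A ∈ 𝒜 × A ∩ X ≡ Y)

record MaximalChain {n : ℕ} (r : ℕ) (X : Subset n) : Set where
  field
    chain : Fin (ℕ.suc r) → Subset n
    size  : ∀ i → ∣ chain i ∣ ≡ toℕ i
    incl  : ∀ (i : Fin r) → chain (inject₁ i) ⊆ chain (fsuc i)
    top   : chain (fromℕ r) ≡ X

TraceHasMaxChain : ∀ {n} → Family n → (r : ℕ) → Subset n → Set
TraceHasMaxChain 𝒜 r X =
  Σ (MaximalChain r X) λ C → ∀ i → InTrace 𝒜 X (MaximalChain.chain C i)

Admissible : (n k r : ℕ) → Family n → Set
Admissible n k r 𝒜 =
  IsKFamily k 𝒜 × (∀ (X : Subset n) → ∣ X ∣ ≡ r → ¬ TraceHasMaxChain 𝒜 r X)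

IsW : (n k r m : ℕ) → Set
IsW n k r m =
  (∃[ 𝒜 ] (Admissible n k r 𝒜 × length 𝒜 ≡ m))
  × (∀ (𝒜 : Family n) → Admissible n k r 𝒜 → length 𝒜 ≤ m)

{-# OPTIONS --safe #-}
-- A chain with points x₁, …, xᵣ can be built from the bottom: if a ∈ 𝒜 misses x = x₁ and the
-- members through x contain a chain of length r ∸ 1 with points outside a, then 𝒜 contains a
-- chain of length r.
--
-- Induct on k, with r = s + 1 and n = d + k, and suppose 𝒜 contains no chain.  A point common to
-- all members can be deleted, lowering k and n by one and keeping d.  The case k = s is the
-- trivial bound C(n, k).  Otherwise k > s and every point x is missed by some member, which gives
-- deg x = O(nˢ⁻¹).  Only boundedly many y have codegree with x above ε nˢ⁻¹, so a large 𝒜 has a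
-- member a avoiding x and all these y.  The members through x that are otherwise disjoint from a
-- contain no chain of length s, whence deg x ≤ C(d + s ∸ 1, s ∸ 1) + k ε nˢ⁻¹.  Summing over x,
-- k |𝒜| ≤ n (1 + O(ε)) C(d + s ∸ 1, s ∸ 1), and as k > s this is below k C(d + s, s) for large n.
--
-- Equality is attained by the k-sets containing a fixed (k ∸ s)-set F: a set X disjoint from a
-- member avoids F, so a member containing X forces |X| ≤ s.

module Submission where

open import Defs
open import Data.Nat using (ℕ; zero; suc; _≤_; _<_; _∸_; _+_; _*_; _^_; z≤n; s≤s; _≤?_; _<?_; _!; NonZero)
open import Data.Nat.Combinatorics using (_C_; nCk+nC[k+1]≡[n+1]C[k+1]; nC1≡n)
open import Data.Nat.ListAction using (sum)
open import Data.Nat.Properties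
open import Data.Nat.Solver using (module +-*-Solver)
open import Data.Fin.Properties using (toℕ-fromℕ)
open import Data.Fin.Subset using (Subset; inside; outside; _∈_; _∉_; _⊆_; _∩_; _∪_; ⁅_⁆; ⊥; ∣_∣)
open import Data.Fin.Subset.Properties
open import Data.Fin using (Fin; toℕ; inject₁; fromℕ) renaming (zero to fzero; suc to fsuc)
open import Data.List using (List; []; _∷_; length; filter; map; allFin; tabulate; _++_)
open import Data.List.Properties using (filter-none; filter-some; length-map; length-++; length-tabulate)
open import Data.List.Membership.Propositional using (find; lose) renaming (_∈_ to _∈ˡ_)
open import Data.List.Membership.Propositional.Properties using (∈-filter⁺; ∈-filter⁻; ∈-allFin; ∈-map⁻)
open import Data.List.Relation.Unary.All as All using (All; []; _∷_)
open import Data.List.Relation.Unary.AllPairs using ([]; _∷_)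
open import Data.List.Relation.Unary.Any as Any using (Any; here; there; _─_)
open import Data.List.Relation.Unary.Unique.Propositional using (Unique)
import Data.List.Relation.Unary.Unique.Propositional.Properties as Unique
open import Data.Vec using ([]; _∷_; replicate; here; there) renaming (_++_ to _++ᵛ_)
open import Data.Vec.Properties using (∷-injectiveʳ; ++-injectiveʳ)
open import Data.Product using (_×_; _,_; proj₁; proj₂; ∃-syntax)
open import Data.Sum using (_⊎_; inj₁; inj₂; [_,_]′)
open import Data.Unit using (tt)
open import Data.Empty using (⊥-elim)
open import Function using (_∘_; id)
open import Relation.Binary.PropositionalEquality
open import Data.List.Relation.Unary.All.Properties as All using (¬All⇒Any¬)
open import Relation.Nullary using (¬_; Dec; yes; no; ¬?; contradiction)
open import Relation.Nullary.Decidable using (_⊎-dec_)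
open import Relation.Unary using (Decidable)

-- Counting and summation over lists

count : ∀ {A : Set} {P : A → Set} → Decidable P → List A → ℕ
count P? xs = length (filter P? xs)

count-none : ∀ {A : Set} {P : A → Set} (P? : Decidable P) (xs : List A) →
  count P? xs ≡ 0 → ∀ {x} → x ∈ˡ xs → ¬ P x
count-none P? xs eq x∈ px with () ← subst (0 <_) eq (filter-some P? (Any.map (λ { refl → px }) x∈))

count-⊎ : ∀ {A : Set} {P Q R : A → Set} (P? : Decidable P) (Q? : Decidable Q) (R? : Decidable R) (xs : List A) →
  (∀ {x} → R x → P x ⊎ Q x) → count R? xs ≤ count P? xs + count Q? xs
count-⊎ P? Q? R? [] R⊆ = z≤n
count-⊎ P? Q? R? (x ∷ xs) R⊆ with P? x | Q? x | R? x | count-⊎ P? Q? R? xs R⊆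
... | yes _ | yes _ | yes _ | ih = s≤s (≤-trans ih (+-monoʳ-≤ (count P? xs) (n≤1+n _)))
... | yes _ | yes _ | no _  | ih = m≤n⇒m≤1+n (≤-trans ih (+-monoʳ-≤ (count P? xs) (n≤1+n _)))
... | yes _ | no _  | yes _ | ih = s≤s ih
... | yes _ | no _  | no _  | ih = m≤n⇒m≤1+n ih
... | no _  | yes _ | yes _ | ih = ≤-trans (s≤s ih) (≤-reflexive (sym (+-suc _ _)))
... | no _  | yes _ | no _  | ih = ≤-trans (m≤n⇒m≤1+n ih) (≤-reflexive (sym (+-suc _ _)))
... | no ¬p | no ¬q | yes r | ih = ⊥-elim ([ ¬p , ¬q ]′ (R⊆ r))
... | no _  | no _  | no _  | ih = ih

count-split : ∀ {A : Set} {P : A → Set} (P? : Decidable P) (xs : List A) →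
  length xs ≡ count P? xs + count (¬? ∘ P?) xs
count-split P? [] = refl
count-split P? (x ∷ xs) with P? x
... | yes _ = cong suc (count-split P? xs)
... | no _  = trans (cong suc (count-split P? xs)) (sym (+-suc _ _))

module _ {A : Set} {x : A} where

  length-─ : ∀ {xs} (p : x ∈ˡ xs) → length xs ≡ suc (length (xs ─ p))
  length-─ (here _) = refl
  length-─ (there p@(here _)) = cong suc (length-─ p)
  length-─ (there p@(there _)) = cong suc (length-─ p)

  ∈-─⁺ : ∀ {xs y} (p : x ∈ˡ xs) → y ∈ˡ xs → y ≡ x ⊎ y ∈ˡ (xs ─ p)
  ∈-─⁺ (here refl) (here refl) = inj₁ refl
  ∈-─⁺ (here _) (there q) = inj₂ q
  ∈-─⁺ (there p) (here refl) = inj₂ (here refl)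
  ∈-─⁺ (there p) (there q) with ∈-─⁺ p q
  ... | inj₁ eq = inj₁ eq
  ... | inj₂ r = inj₂ (there r)

  ∈-─⁻ : ∀ {xs y} (p : x ∈ˡ xs) → y ∈ˡ (xs ─ p) → y ∈ˡ xs
  ∈-─⁻ (here _) q = there q
  ∈-─⁻ (there p) (here refl) = here refl
  ∈-─⁻ (there p) (there q) = there (∈-─⁻ p q)

  count-─-accept : ∀ {P : A → Set} (P? : Decidable P) {xs} (p : x ∈ˡ xs) → P x →
    count P? xs ≡ suc (count P? (xs ─ p))
  count-─-accept P? {y ∷ xs} (here refl) px with P? y
  ... | yes _ = refl
  ... | no ¬px = contradiction px ¬px
  count-─-accept P? {y ∷ xs} (there p) px with P? y
  ... | yes _ = cong suc (count-─-accept P? p px)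
  ... | no _ = count-─-accept P? p px

  count-─-≤ : ∀ {P : A → Set} (P? : Decidable P) {xs} (p : x ∈ˡ xs) → count P? (xs ─ p) ≤ count P? xs
  count-─-≤ P? {y ∷ xs} (here _) with P? y
  ... | yes _ = n≤1+n _
  ... | no _ = ≤-refl
  count-─-≤ P? {y ∷ xs} (there p) with P? y
  ... | yes _ = s≤s (count-─-≤ P? p)
  ... | no _ = count-─-≤ P? p

∑ : ∀ {A : Set} → (A → ℕ) → List A → ℕ
∑ f xs = sum (map f xs)

-- Meant for few exceptional entries with a large bound: `c` is charged to every entry, also to
-- those in `Z`, so that only `Z` has to be counted.
∑-≤-two-valued : ∀ {A : Set} {Z : A → Set} (Z? : Decidable Z) (f : A → ℕ) {b c : ℕ} (xs : List A) →
  (∀ {x} → x ∈ˡ xs → Z x → f x ≤ b) → (∀ {x} → x ∈ˡ xs → ¬ Z x → f x ≤ c) →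
  ∑ f xs ≤ count Z? xs * b + length xs * c
∑-≤-two-valued Z? f [] onZ offZ = z≤n
∑-≤-two-valued Z? f {b} {c} (x ∷ xs) onZ offZ
  with Z? x | ∑-≤-two-valued Z? f {b} {c} xs (onZ ∘ there) (offZ ∘ there)
... | yes z | ih = begin
  f x + ∑ f xs                                   ≤⟨ +-mono-≤ (onZ (here refl) z) ih ⟩
  b + (count Z? xs * b + length xs * c)          ≡⟨ +-assoc b _ _ ⟨
  b + count Z? xs * b + length xs * c            ≤⟨ +-monoʳ-≤ (b + count Z? xs * b) (m≤n+m (length xs * c) c) ⟩
  b + count Z? xs * b + (c + length xs * c)      ∎
  where open ≤-Reasoning
... | no ¬z | ih = begin
  f x + ∑ f xs                                   ≤⟨ +-mono-≤ (offZ (here refl) ¬z) ih ⟩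
  c + (count Z? xs * b + length xs * c)          ≡⟨ solve 3 (λ c u v → c :+ (u :+ v) := u :+ (c :+ v)) refl c _ (length xs * c) ⟩
  count Z? xs * b + (c + length xs * c)          ∎
  where open ≤-Reasoning
        open +-*-Solver

∑-≤ : ∀ {A : Set} (f : A → ℕ) {c : ℕ} (xs : List A) → (∀ {x} → x ∈ˡ xs → f x ≤ c) →
  ∑ f xs ≤ length xs * c
∑-≤ f [] h = z≤n
∑-≤ f (x ∷ xs) h = +-mono-≤ (h (here refl)) (∑-≤ f xs (h ∘ there))

∑-≡ : ∀ {A : Set} (f : A → ℕ) {c : ℕ} (xs : List A) → (∀ {x} → x ∈ˡ xs → f x ≡ c) →
  ∑ f xs ≡ length xs * c
∑-≡ f [] h = refl
∑-≡ f (x ∷ xs) h = cong₂ _+_ (h (here refl)) (∑-≡ f xs (h ∘ there))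

length≤∑ : ∀ {A : Set} {f : A → ℕ} (xs : List A) → (∀ {x} → x ∈ˡ xs → 1 ≤ f x) → length xs ≤ ∑ f xs
length≤∑ [] h = z≤n
length≤∑ (x ∷ xs) h = +-mono-≤ (h (here refl)) (length≤∑ xs (h ∘ there))

∑-*ˡ : ∀ {A : Set} (q : ℕ) (f : A → ℕ) (xs : List A) → ∑ (λ x → q * f x) xs ≡ q * ∑ f xs
∑-*ˡ q f [] = sym (*-zeroʳ q)
∑-*ˡ q f (x ∷ xs) = trans (cong (q * f x +_) (∑-*ˡ q f xs)) (sym (*-distribˡ-+ q (f x) (∑ f xs)))

markov : ∀ {A : Set} {P : A → Set} (P? : Decidable P) (f : A → ℕ) {w : ℕ} (xs : List A) →
  (∀ {x} → P x → w ≤ f x) → count P? xs * w ≤ ∑ f xs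
markov P? f [] h = z≤n
markov P? f (x ∷ xs) h with P? x
... | yes px = +-mono-≤ (h px) (markov P? f xs h)
... | no _ = ≤-trans (markov P? f xs h) (m≤n+m _ (f x))

-- Incidences between points and members

module _ {V I : Set} {R : V → I → Set} (R? : ∀ x a → Dec (R x a)) where

  private
    ∑-count-∷ : ∀ a 𝒜 G → ∑ (λ x → count (R? x) (a ∷ 𝒜)) G
      ≡ count (λ x → R? x a) G + ∑ (λ x → count (R? x) 𝒜) G
    ∑-count-∷ a 𝒜 [] = refl
    ∑-count-∷ a 𝒜 (x ∷ G) with R? x a
    ... | yes _ = cong suc (trans (cong (count (R? x) 𝒜 +_) (∑-count-∷ a 𝒜 G)) (swap (count (R? x) 𝒜) (count (λ y → R? y a) G) _))
      where open +-*-Solver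
            swap = solve 3 (λ u v w → u :+ (v :+ w) := v :+ (u :+ w)) refl
    ... | no _ = trans (cong (count (R? x) 𝒜 +_) (∑-count-∷ a 𝒜 G)) (swap (count (R? x) 𝒜) (count (λ y → R? y a) G) _)
      where open +-*-Solver
            swap = solve 3 (λ u v w → u :+ (v :+ w) := v :+ (u :+ w)) refl

    ∑-zero : (G : List V) → ∑ (λ _ → 0) G ≡ 0
    ∑-zero [] = refl
    ∑-zero (_ ∷ G) = ∑-zero G

  double-counting : ∀ 𝒜 G → ∑ (λ x → count (R? x) 𝒜) G ≡ ∑ (λ a → count (λ x → R? x a) G) 𝒜
  double-counting [] G = ∑-zero G
  double-counting (a ∷ 𝒜) G = trans (∑-count-∷ a 𝒜 G) (cong (_ +_) (double-counting 𝒜 G))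

  meets? : (L : List V) → Decidable (λ a → Any (λ x → R x a) L)
  meets? L a = Any.any? (λ x → R? x a) L

  count-meets : ∀ 𝒜 L → count (meets? L) 𝒜 ≤ ∑ (λ x → count (R? x) 𝒜) L
  count-meets 𝒜 [] = ≤-reflexive (cong length (filter-none (meets? []) (All.universal (λ _ ()) 𝒜)))
  count-meets 𝒜 (x ∷ L) = ≤-trans (count-⊎ (R? x) (meets? L) (meets? (x ∷ L)) 𝒜 Any.toSum)
    (+-monoʳ-≤ (count (R? x) 𝒜) (count-meets 𝒜 L))

  -- If every member were incident with an entry of `L`, counting the incidences by members would
  -- give at least `length 𝒜`.
  ∃-avoiding : ∀ 𝒜 L → ∑ (λ x → count (R? x) 𝒜) L < length 𝒜 →
    ∃[ a ] (a ∈ˡ 𝒜 × (∀ {x} → x ∈ˡ L → ¬ R x a))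
  ∃-avoiding 𝒜 L lt with Any.any? (λ a → All.all? (λ x → ¬? (R? x a)) L) 𝒜
  ... | yes p = let (a , a∈ , av) = find p in a , a∈ , All.lookup av
  ... | no ¬p = contradiction lt (≤⇒≯ (begin
    length 𝒜                                ≤⟨ length≤∑ 𝒜 (λ a∈ → met (λ av → ¬p (lose a∈ av))) ⟩
    ∑ (λ a → count (λ x → R? x a) L) 𝒜       ≡⟨ double-counting 𝒜 L ⟨
    ∑ (λ x → count (R? x) 𝒜) L              ∎))
    where
    open ≤-Reasoning
    met : ∀ {a} → ¬ All (λ x → ¬ R x a) L → 1 ≤ count (λ x → R? x a) L
    met {a} ¬all with count (λ x → R? x a) L in eq
    ... | zero = contradiction (All.tabulate (count-none (λ x → R? x a) L eq)) ¬all
    ... | suc _ = s≤s z≤n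

-- Binomial estimates and the constants of the upper bound

[1+n]C[1+k]*[1+k]≡[1+n]*nCk : ∀ n k → (suc n C suc k) * suc k ≡ suc n * (n C k)
[1+n]C[1+k]*[1+k]≡[1+n]*nCk zero zero = refl
[1+n]C[1+k]*[1+k]≡[1+n]*nCk zero (suc k) = refl
[1+n]C[1+k]*[1+k]≡[1+n]*nCk (suc n) zero = cong (_* 1) {suc (suc n) C 1} {suc (suc n)} (nC1≡n (suc (suc n)))
[1+n]C[1+k]*[1+k]≡[1+n]*nCk (suc n) (suc k) = begin
  (suc (suc n) C suc (suc k)) * suc (suc k)
    ≡⟨ cong (_* suc (suc k)) (nCk+nC[k+1]≡[n+1]C[k+1] (suc n) (suc k)) ⟨
  (u + v) * suc (suc k)
    ≡⟨ solve 3 (λ u v k → (u :+ v) :* (con 2 :+ k) := u :* (con 1 :+ k) :+ v :* (con 2 :+ k) :+ u) refl u v k ⟩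
  u * suc k + v * suc (suc k) + u
    ≡⟨ cong₂ (λ y z → y + z + u) ([1+n]C[1+k]*[1+k]≡[1+n]*nCk n k) ([1+n]C[1+k]*[1+k]≡[1+n]*nCk n (suc k)) ⟩
  suc n * (n C k) + suc n * (n C suc k) + u
    ≡⟨ cong (_+ u) (*-distribˡ-+ (suc n) (n C k) (n C suc k)) ⟨
  suc n * ((n C k) + (n C suc k)) + u
    ≡⟨ cong (λ y → suc n * y + u) (nCk+nC[k+1]≡[n+1]C[k+1] n k) ⟩
  suc n * u + u
    ≡⟨ +-comm (suc n * u) u ⟩
  suc (suc n) * u ∎
  where
  open ≡-Reasoning
  open +-*-Solver
  u = suc n C suc k
  v = suc n C suc (suc k)

-- The right side is the product of `d + 1`, ..., `d + t`, and each of these `t` factors is at least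
-- `suc d`.
[1+d]^t≤t!*[d+t]Ct : ∀ d t → suc d ^ t ≤ t ! * ((d + t) C t)
[1+d]^t≤t!*[d+t]Ct d zero = ≤-refl
[1+d]^t≤t!*[d+t]Ct d (suc t) = begin
  suc d * suc d ^ t                          ≤⟨ *-mono-≤ (s≤s (m≤m+n d t)) ([1+d]^t≤t!*[d+t]Ct d t) ⟩
  suc (d + t) * (t ! * ((d + t) C t))          ≡⟨ swap (suc (d + t)) (t !) ((d + t) C t) ⟩
  t ! * (suc (d + t) * ((d + t) C t))          ≡⟨ cong (t ! *_) ([1+n]C[1+k]*[1+k]≡[1+n]*nCk (d + t) t) ⟨
  t ! * ((suc (d + t) C suc t) * suc t)        ≡⟨ rot (t !) (suc (d + t) C suc t) (suc t) ⟩
  suc t * t ! * (suc (d + t) C suc t)          ≡⟨ cong (λ n → suc t * t ! * (n C suc t)) (+-suc d t) ⟨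
  suc t * t ! * ((d + suc t) C suc t)          ∎
  where
  open ≤-Reasoning
  open +-*-Solver
  swap = solve 3 (λ a b c → a :* (b :* c) := b :* (a :* c)) refl
  rot = solve 3 (λ a b c → a :* (b :* c) := c :* a :* b) refl

^-distribʳ-* : ∀ m n t → (m * n) ^ t ≡ m ^ t * n ^ t
^-distribʳ-* m n zero = refl
^-distribʳ-* m n (suc t) = trans (cong (m * n *_) (^-distribʳ-* m n t)) ([m*n]*[o*p]≡[m*o]*[n*p] m n (m ^ t) (n ^ t))

-- As `d + k` is at most `suc k * suc d`, an error term of order nᵗ, with n = `d + k`, is at most a
-- constant multiple of the main binomial.
[d+k]^t≤ : ∀ d k t → (d + k) ^ t ≤ suc k ^ t * t ! * ((d + t) C t)
[d+k]^t≤ d k t = begin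
  (d + k) ^ t                                ≤⟨ ^-monoˡ-≤ t (≤-trans (m≤m+n (d + k) (1 + d * k)) (≤-reflexive (expand d k))) ⟩
  (suc k * suc d) ^ t                        ≡⟨ ^-distribʳ-* (suc k) (suc d) t ⟩
  suc k ^ t * suc d ^ t                      ≤⟨ *-monoʳ-≤ (suc k ^ t) ([1+d]^t≤t!*[d+t]Ct d t) ⟩
  suc k ^ t * (t ! * ((d + t) C t))            ≡⟨ *-assoc (suc k ^ t) (t !) _ ⟨
  suc k ^ t * t ! * ((d + t) C t)              ∎
  where
  open ≤-Reasoning
  open +-*-Solver
  expand = solve 2 (λ d k → d :+ k :+ (con 1 :+ d :* k) := (con 1 :+ k) :* (con 1 :+ d)) refl

-- The slack is k ≥ t + 2 against the factor t + 1 in (t + 1) M = (d + t + 1) p.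
slack : ∀ d k t q {A M p w} .{{_ : NonZero q}} → 2 + t ≤ k → k ≤ d → w ≤ q * p →
  M * suc t ≡ suc (d + t) * p →
  2 * (suc t * k * q) * (A * k) ≤ (d + k) * (2 * (suc t * k * q) * p + k * w) → A ≤ M
slack d k@(suc k′) t q {A} {M} {p} {w} (s≤s t<k′) k≤d w≤ M≡ hyp = *-cancelʳ-≤ A M (2 * u * k * T) (begin
  A * (2 * u * k * T)                        ≡⟨ solve 4 (λ A u k T → A :* (con 2 :* u :* k :* T) := T :* (con 2 :* u :* (A :* k))) refl A u k T ⟩
  T * (2 * u * (A * k))                      ≤⟨ *-monoʳ-≤ T hyp ⟩
  T * ((d + k) * (2 * u * p + k * w))        ≤⟨ *-monoʳ-≤ T (*-monoʳ-≤ (d + k) (+-monoʳ-≤ (2 * u * p) (*-monoʳ-≤ k w≤))) ⟩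
  -- Since `u = T * k * q`, the error term yields exactly one `u * p` per point, against `2 * T` of
  -- them from the main term.
  T * ((d + k) * (2 * u * p + k * (q * p)))  ≡⟨ solve 5 (λ T d k q p → let u = T :* k :* q in
                                                  T :* ((d :+ k) :* (con 2 :* u :* p :+ k :* (q :* p)))
                                                  := (con 2 :* T :* (d :+ k) :+ (d :+ k)) :* (u :* p)) refl T d k q p ⟩
  (2 * T * (d + k) + (d + k)) * (u * p)      ≤⟨ *-monoˡ-≤ (u * p) core ⟩
  2 * k * (d + T) * (u * p)                  ≡⟨ solve 4 (λ k e u p → con 2 :* k :* e :* (u :* p) := con 2 :* u :* k :* (e :* p)) refl k (d + T) u p ⟩
  2 * u * k * ((d + T) * p)                  ≡⟨ cong (λ e → 2 * u * k * (e * p)) (+-suc d t) ⟩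
  2 * u * k * (suc (d + t) * p)              ≡⟨ cong (2 * u * k *_) M≡ ⟨
  2 * u * k * (M * T)                        ≡⟨ solve 4 (λ u k M T → con 2 :* u :* k :* (M :* T) := M :* (con 2 :* u :* k :* T)) refl u k M T ⟩
  M * (2 * u * k * T)                        ∎)
  where
  open ≤-Reasoning
  open +-*-Solver
  T = suc t
  u = T * k * q
  instance
    _ : NonZero (2 * u * k * T)
    _ = m*n≢0 (2 * u * k) T {{m*n≢0 (2 * u) k {{m*n≢0 2 u {{_}} {{m*n≢0 (T * k) q}}}}}}
  -- By `k ≤ d` the surplus `d + k` is at most `2 * d`, which raises the coefficient `2 * T` of `d`
  -- to `2 * suc T`; this is at most `2 * k`.
  core : 2 * T * (d + k) + (d + k) ≤ 2 * k * (d + T)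
  core = begin
    2 * T * (d + k) + (d + k)                ≤⟨ +-monoʳ-≤ (2 * T * (d + k)) (+-monoʳ-≤ d k≤d) ⟩
    2 * T * (d + k) + (d + d)                ≡⟨ solve 3 (λ T d k → con 2 :* T :* (d :+ k) :+ (d :+ d) := con 2 :* (con 1 :+ T) :* d :+ con 2 :* k :* T) refl T d k ⟩
    2 * suc T * d + 2 * k * T                ≤⟨ +-monoˡ-≤ (2 * k * T) (*-monoˡ-≤ d (*-monoʳ-≤ 2 (s≤s t<k′))) ⟩
    2 * k * d + 2 * k * T                    ≡⟨ *-distribˡ-+ (2 * k) d T ⟨
    2 * k * (d + T)                          ∎

-- The recursion behind `chainless-crude`, with `z` bounding the number of excluded points: at most
-- `z + suc k` points are excluded or lie in a chosen member, and for all others that member joins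
-- the excluded points.
crudeBound : ℕ → ℕ → ℕ
crudeBound zero    z = 1
crudeBound (suc k) z = (z + suc k) * crudeBound k z + crudeBound k (z + suc k)

-- Write n = `d + k`. Then nᵗ is at most `q` times C(d + t, t), a degree is at most `c` nᵗ, the ε of
-- the argument is 1 / `Q`, and more than `K` nᵗ members suffice to find one that avoids `x` and all
-- points of large codegree with it.
module Constants (t k′ : ℕ) where

  k = suc k′
  q = suc k ^ t * t !
  c = crudeBound k′ k
  Q = 2 * (suc t * k * q)
  K = suc (Q * k′ * c) * c

-- A bound on d = n ∸ k. The summands serve in turn the deletion of a common point, the induction
-- inside a star, the comparison in `slack`, and families with at most `K` nᵗ members.
threshold : ℕ → ℕ → ℕ
threshold zero    s       = 0
threshold (suc k) zero    = 0
threshold (suc k) (suc t) = threshold k (suc t) + (threshold k t + (suc k + K * q * suc t))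
  where open Constants t k using (K; q)

-- Uniform families and chains over an abstract incidence relation

module Incidence {V I : Set} {_∈_ : V → I → Set} (_∈?_ : ∀ x a → Dec (x ∈ a)) where

  star : V → List I → List I
  star x = filter (x ∈?_)

  -- A uniform family whose members need only be told apart by their points in G:
  -- passing to the star of x just deletes x from G, and no set is ever modified.
  record Uniform (k : ℕ) (G : List V) (𝒜 : List I) : Set where
    field
      unique    : Unique 𝒜
      degree    : ∀ {a} → a ∈ˡ 𝒜 → count (_∈? a) G ≡ k
      separated : ∀ {a b} → a ∈ˡ 𝒜 → b ∈ˡ 𝒜 →
                  (∀ {x} → x ∈ˡ G → x ∈ a → x ∈ b) → (∀ {x} → x ∈ˡ G → x ∈ b → x ∈ a) → a ≡ b

  open Uniform

  uniform-filter : ∀ {k G 𝒜} {P : I → Set} (P? : Decidable P) → Uniform k G 𝒜 → Uniform k G (filter P? 𝒜)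
  uniform-filter P? u .unique = Unique.filter⁺ P? (unique u)
  uniform-filter P? u .degree a∈ = degree u (proj₁ (∈-filter⁻ P? a∈))
  uniform-filter P? u .separated a∈ b∈ = separated u (proj₁ (∈-filter⁻ P? a∈)) (proj₁ (∈-filter⁻ P? b∈))

  -- All members contain `x`, so deleting it costs each of them one incidence and erases no
  -- difference between them.
  uniform-─ : ∀ {k G 𝒜 x} (p : x ∈ˡ G) → (∀ {a} → a ∈ˡ 𝒜 → x ∈ a) →
    Uniform (suc k) G 𝒜 → Uniform k (G ─ p) 𝒜
  uniform-─ p x∈ u .unique = unique u
  uniform-─ p x∈ u .degree {a} a∈ =
    suc-injective (trans (sym (count-─-accept (_∈? a) p (x∈ a∈))) (degree u a∈))
  uniform-─ {G = G} {x = x} p x∈ u .separated a∈ b∈ a⊆b b⊆a = separated u a∈ b∈ (extend b∈ a⊆b) (extend a∈ b⊆a)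
    where
    extend : ∀ {a b} → b ∈ˡ _ → (∀ {y} → y ∈ˡ (G ─ p) → y ∈ a → y ∈ b) → ∀ {y} → y ∈ˡ G → y ∈ a → y ∈ b
    extend b∈ sub y∈ y∈a with ∈-─⁺ p y∈
    ... | inj₁ refl = x∈ b∈
    ... | inj₂ y∈′ = sub y∈′ y∈a

  uniform-star : ∀ {k G 𝒜 x} (p : x ∈ˡ G) → Uniform (suc k) G 𝒜 → Uniform k (G ─ p) (star x 𝒜)
  uniform-star {𝒜 = 𝒜} {x} p u = uniform-─ p (λ a∈ → proj₂ (∈-filter⁻ (x ∈?_) {xs = 𝒜} a∈)) (uniform-filter (x ∈?_) u)

  -- Pascal's rule, splitting by the first point of `G`. Over an empty ground list no two members
  -- can be told apart.
  uniform-length : ∀ {k} G {𝒜} → Uniform k G 𝒜 → length 𝒜 ≤ length G C k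
  uniform-length G {[]} u = z≤n
  uniform-length [] {a ∷ []} u with refl ← degree u (here refl) = ≤-refl
  uniform-length [] {a ∷ b ∷ 𝒜} u with (a≢b ∷ _) ∷ _ ← unique u =
    contradiction (separated u (here refl) (there (here refl)) (λ ()) (λ ())) a≢b
  uniform-length {k} (x ∷ G) {𝒜@(_ ∷ _)} u = begin
    length 𝒜                                        ≡⟨ count-split (x ∈?_) 𝒜 ⟩
    length (star x 𝒜) + length (filter (¬? ∘ (x ∈?_)) 𝒜)  ≤⟨ bound k u ⟩
    suc (length G) C k                              ∎
    where
    open ≤-Reasoning
    without : ∀ {k} → Uniform k (x ∷ G) 𝒜 → Uniform k G (filter (¬? ∘ (x ∈?_)) 𝒜)
    without u .unique = Unique.filter⁺ (¬? ∘ (x ∈?_)) (unique u)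
    without u .degree {a} a∈ with ∈-filter⁻ (¬? ∘ (x ∈?_)) a∈
    ... | a∈𝒜 , x∉a with x ∈? a | degree u a∈𝒜
    ... | yes x∈a | _ = contradiction x∈a x∉a
    ... | no _ | eq = eq
    without u .separated {a} {b} a∈ b∈ a⊆b b⊆a with ∈-filter⁻ (¬? ∘ (x ∈?_)) a∈ | ∈-filter⁻ (¬? ∘ (x ∈?_)) b∈
    ... | a∈𝒜 , x∉a | b∈𝒜 , x∉b = separated u a∈𝒜 b∈𝒜
      (λ { (here refl) x∈a → contradiction x∈a x∉a ; (there y∈) → a⊆b y∈ })
      (λ { (here refl) x∈b → contradiction x∈b x∉b ; (there y∈) → b⊆a y∈ })
    bound : ∀ k → Uniform k (x ∷ G) 𝒜 → length (star x 𝒜) + length (filter (¬? ∘ (x ∈?_)) 𝒜) ≤ suc (length G) C k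
    bound zero u = begin
      length (star x 𝒜) + length (filter (¬? ∘ (x ∈?_)) 𝒜)
        ≡⟨ cong (λ l → length l + length (filter (¬? ∘ (x ∈?_)) 𝒜))
             (filter-none (x ∈?_) (All.tabulate (λ {a} a∈ → count-none (_∈? a) (x ∷ G) (degree u a∈) (here refl)))) ⟩
      length (filter (¬? ∘ (x ∈?_)) 𝒜)
        ≤⟨ uniform-length G (without u) ⟩
      length G C 0 ∎
    bound (suc k) u = begin
      length (star x 𝒜) + length (filter (¬? ∘ (x ∈?_)) 𝒜)
        ≤⟨ +-mono-≤ (uniform-length G (uniform-star (here refl) u)) (uniform-length G (without u)) ⟩
      length G C k + length G C suc k
        ≡⟨ nCk+nC[k+1]≡[n+1]C[k+1] (length G) k ⟩
      suc (length G) C suc k ∎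

  ∑-star : ∀ {k G 𝒜} → Uniform k G 𝒜 → ∑ (λ x → length (star x 𝒜)) G ≡ length 𝒜 * k
  ∑-star {G = G} {𝒜} u = trans (double-counting _∈?_ 𝒜 G) (∑-≡ (λ a → count (_∈? a) G) 𝒜 (degree u))

  -- A chain x₁, …, xᵣ of points satisfying P, built from the bottom: the first member a
  -- contains none of the points, all the later ones contain x = x₁, and x₂, …, xᵣ ∉ a.
  data Chain (P : V → Set) (𝒜 : List I) : ℕ → Set₁ where
    nil  : ∀ {a} → a ∈ˡ 𝒜 → Chain P 𝒜 0
    cons : ∀ {a x r} → a ∈ˡ 𝒜 → ¬ x ∈ a → P x →
           Chain (λ y → P y × ¬ y ∈ a) (star x 𝒜) r → Chain P 𝒜 (suc r)

  chain-nonempty : ∀ {P 𝒜 r} → Chain P 𝒜 r → ∃[ a ] a ∈ˡ 𝒜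
  chain-nonempty (nil a∈) = _ , a∈
  chain-nonempty (cons a∈ _ _ _) = _ , a∈

  -- Each point of a chain lies in some member, because the rest of the chain is nonempty and lives
  -- in the star of that point. So `P` has to imply `P′` only at points covered by `𝒜`, which is how
  -- members disjoint from a set yield chains outside it.
  chain-mono : ∀ {P P′ : V → Set} {𝒜 𝒜′ r} → (∀ {a} → a ∈ˡ 𝒜 → a ∈ˡ 𝒜′) →
    (∀ {a y} → a ∈ˡ 𝒜 → y ∈ a → P y → P′ y) → Chain P 𝒜 r → Chain P′ 𝒜′ r
  chain-mono 𝒜⊆ P⊆ (nil a∈) = nil (𝒜⊆ a∈)
  chain-mono 𝒜⊆ P⊆ (cons {x = x} a∈ x∉a px ch) =
    cons (𝒜⊆ a∈) x∉a (P⊆ (proj₁ b∈) (proj₂ b∈) px)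
      (chain-mono (λ c∈ → let (c∈𝒜 , x∈c) = ∈-filter⁻ (x ∈?_) c∈ in ∈-filter⁺ (x ∈?_) (𝒜⊆ c∈𝒜) x∈c)
        (λ c∈ y∈c (py , y∉a) → P⊆ (proj₁ (∈-filter⁻ (x ∈?_) c∈)) y∈c py , y∉a) ch)
    where
    b∈ = ∈-filter⁻ (x ∈?_) (proj₂ (chain-nonempty ch))

  chain-star : ∀ {P 𝒜 x r} → Chain P (star x 𝒜) r → Chain P 𝒜 r
  chain-star {x = x} = chain-mono (proj₁ ∘ ∈-filter⁻ (x ∈?_)) (λ _ _ → id)

  chainless-zero : ∀ {P 𝒜} → ¬ Chain P 𝒜 0 → length 𝒜 ≡ 0
  chainless-zero {𝒜 = []} _ = refl
  chainless-zero {𝒜 = _ ∷ _} ¬ch = contradiction (nil (here refl)) ¬ch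

  -- |𝒜| ≤ ∑ₓ |star x 𝒜|, where for the boundedly many x ∈ Z ∪ a only k drops,
  -- and for all other x both k and r drop.
  chainless-crude : ∀ k r {z m G 𝒜} {P Z : V → Set} (Z? : Decidable Z) .{{_ : NonZero m}} → Uniform k G 𝒜 →
    length G ≤ m → count Z? G ≤ z → (∀ {x} → x ∈ˡ G → ¬ Z x → P x) → ¬ Chain P 𝒜 (suc r) →
    length 𝒜 ≤ crudeBound k z * m ^ r
  chainless-crude k r {𝒜 = []} Z? u _ _ _ _ = z≤n
  chainless-crude zero r {z} {m} {G} {𝒜} Z? u _ _ _ _ = begin
    length 𝒜      ≤⟨ uniform-length G u ⟩
    1             ≤⟨ m^n>0 m r ⟩
    m ^ r         ≡⟨ *-identityˡ _ ⟨
    1 * m ^ r     ∎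
    where open ≤-Reasoning
  chainless-crude (suc k) r {z} {m} {G} {𝒜@(a ∷ _)} {P} {Z} Z? u |G|≤m |Z|≤z Z⇒P ¬ch = begin
    length 𝒜
      ≤⟨ m≤m*n (length 𝒜) (suc k) ⟩
    length 𝒜 * suc k
      ≡⟨ ∑-star u ⟨
    ∑ (λ x → length (star x 𝒜)) G
      ≤⟨ ∑-≤-two-valued Z∪a? (λ x → length (star x 𝒜)) G
           (λ x∈ _ → chainless-crude k r Z? (uniform-star x∈ u) (|G─|≤m x∈)
              (≤-trans (count-─-≤ Z? x∈) |Z|≤z) (λ y∈ → Z⇒P (∈-─⁻ x∈ y∈)) (¬ch ∘ chain-star))
           (λ x∈ x∉ → offBound r ¬ch x∈ (x∉ ∘ inj₁) (x∉ ∘ inj₂)) ⟩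
    count Z∪a? G * (crudeBound k z * m ^ r) + length G * off r
      ≤⟨ +-mono-≤ (*-monoˡ-≤ (crudeBound k z * m ^ r) |Z∪a|≤) (*-off r) ⟩
    (z + suc k) * (crudeBound k z * m ^ r) + crudeBound k (z + suc k) * m ^ r
      ≡⟨ cong (_+ crudeBound k (z + suc k) * m ^ r) (*-assoc (z + suc k) (crudeBound k z) (m ^ r)) ⟨
    (z + suc k) * crudeBound k z * m ^ r + crudeBound k (z + suc k) * m ^ r
      ≡⟨ *-distribʳ-+ (m ^ r) ((z + suc k) * crudeBound k z) (crudeBound k (z + suc k)) ⟨
    crudeBound (suc k) z * m ^ r ∎
    where
    open ≤-Reasoning
    Z∪a? : Decidable (λ x → Z x ⊎ x ∈ a)
    Z∪a? x = Z? x ⊎-dec (x ∈? a)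

    |Z∪a|≤ : count Z∪a? G ≤ z + suc k
    |Z∪a|≤ = ≤-trans (count-⊎ Z? (_∈? a) Z∪a? G id) (+-mono-≤ |Z|≤z (≤-reflexive (degree u (here refl))))

    |G─|≤m : ∀ {x} (x∈ : x ∈ˡ G) → length (G ─ x∈) ≤ m
    |G─|≤m x∈ = ≤-trans (≤-trans (n≤1+n _) (≤-reflexive (sym (length-─ x∈)))) |G|≤m

    -- For `r = 0` the star of a point outside `Z` and `a` must be empty, since any member of it
    -- completes a chain of length 1 that starts at `a`. Otherwise the exponent drops by one, which
    -- pays for the factor `length G`.
    off : ℕ → ℕ
    off zero    = 0
    off (suc r) = crudeBound k (z + suc k) * m ^ r

    *-off : ∀ r → length G * off r ≤ crudeBound k (z + suc k) * m ^ r
    *-off zero = ≤-trans (≤-reflexive (*-zeroʳ (length G))) z≤n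
    *-off (suc r) = ≤-trans (*-monoˡ-≤ _ |G|≤m)
      (≤-reflexive (solve 3 (λ a b c → a :* (b :* c) := b :* (a :* c)) refl m (crudeBound k (z + suc k)) (m ^ r)))
      where open +-*-Solver

    offBound : ∀ r → ¬ Chain P 𝒜 (suc r) → ∀ {x} → x ∈ˡ G → ¬ Z x → ¬ x ∈ a → length (star x 𝒜) ≤ off r
    offBound zero ¬ch x∈ x∉Z x∉a =
      ≤-reflexive (chainless-zero (λ ch → ¬ch (cons (here refl) x∉a (Z⇒P x∈ x∉Z) ch)))
    offBound (suc r) ¬ch x∈ x∉Z x∉a =
      chainless-crude k r Z∪a? (uniform-star x∈ u) (|G─|≤m x∈) (≤-trans (count-─-≤ Z∪a? x∈) |Z∪a|≤)
        (λ y∈ y∉ → Z⇒P (∈-─⁻ x∈ y∈) (y∉ ∘ inj₁) , y∉ ∘ inj₂)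
        (λ ch → ¬ch (cons (here refl) x∉a (Z⇒P x∈ x∉Z) ch))

  -- W(d + k, k, s + 1) ≤ C(d + s, s).
  Bound : ℕ → ℕ → ℕ → Set₁
  Bound k s d = ∀ {G 𝒜} {P : V → Set} → Uniform k G 𝒜 → length G ≡ d + k →
    (∀ {x} → x ∈ˡ G → P x) → ¬ Chain P 𝒜 (suc s) → length 𝒜 ≤ (d + s) C s

  -- Families without a common point

  Coreless : List V → List I → Set
  Coreless G 𝒜 = ∀ {x} → x ∈ˡ G → ∃[ a ] (a ∈ˡ 𝒜 × ¬ x ∈ a)

  core? : ∀ G 𝒜 → (∃[ x ] (x ∈ˡ G × (∀ {a} → a ∈ˡ 𝒜 → x ∈ a))) ⊎ Coreless G 𝒜
  core? G 𝒜 with Any.any? (λ x → All.all? (x ∈?_) 𝒜) G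
  ... | yes p = let (x , x∈ , h) = find p in inj₁ (x , x∈ , All.lookup h)
  ... | no ¬p = inj₂ (λ {x} x∈ → find (¬All⇒Any¬ (x ∈?_) 𝒜 (λ h → ¬p (lose x∈ h))))

  module Stability (t k′ d : ℕ) (1+t≤k′ : suc t ≤ k′) (Bound-t : Bound k′ t d) where

    open Constants t k′
    m = d + k
    w = m ^ t
    p = (d + t) C t

    instance
      m≢0 : NonZero m
      m≢0 = subst NonZero (sym (+-suc d k′)) _
      q≢0 : NonZero q
      q≢0 = m*n≢0 (suc k ^ t) (t !) {{m^n≢0 (suc k) t}} {{t !≢0}}
      w≢0 : NonZero w
      w≢0 = m^n≢0 m t

    module _ {G 𝒜} {P : V → Set} (u : Uniform k G 𝒜) (|G|≡m : length G ≡ m)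
             (G⊆P : ∀ {x} → x ∈ˡ G → P x) (¬ch : ¬ Chain P 𝒜 (suc (suc t))) (coreless : Coreless G 𝒜) where

      open ≤-Reasoning

      length-G─ : ∀ {x} (x∈ : x ∈ˡ G) → length (G ─ x∈) ≡ d + k′
      length-G─ x∈ = suc-injective (trans (sym (length-─ x∈)) (trans |G|≡m (+-suc d k′)))

      -- Some member `a` misses `x`, and a chain of length `suc t` in the star of `x` with points
      -- outside `a` would extend downwards by `a` and `x`. So the crude bound applies with the
      -- points of `a` excluded.
      star-crude : ∀ {x} → x ∈ˡ G → length (star x 𝒜) ≤ c * w
      star-crude x∈ with a , a∈ , x∉a ← coreless x∈ =
        chainless-crude k′ t (_∈? a) (uniform-star x∈ u)
          (≤-trans (≤-reflexive (length-G─ x∈)) (+-monoʳ-≤ d (n≤1+n k′)))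
          (≤-trans (count-─-≤ (_∈? a) x∈) (≤-reflexive (degree u a∈)))
          (λ y∈ y∉a → G⊆P (∈-─⁻ x∈ y∈) , y∉a)
          (λ ch → ¬ch (cons a∈ x∉a (G⊆P x∈) ch))

      module _ (large : K * w < length 𝒜) {x} (x∈ : x ∈ˡ G) where

        G′ = G ─ x∈
        S  = star x 𝒜

        uS : Uniform k′ G′ S
        uS = uniform-star x∈ u

        -- The points whose codegree with `x` exceeds ε nᵗ.
        bad? : Decidable (λ y → w < Q * length (star y S))
        bad? y = w <? Q * length (star y S)

        bad = filter bad? G′

        -- The codegrees with `x` sum to `k′` times the degree of `x`, which is at most `c * w`;
        -- Markov's inequality does the rest.
        few-bad : length bad ≤ Q * k′ * c
        few-bad = *-cancelʳ-≤ (length bad) (Q * k′ * c) w (begin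
          length bad * w                               ≤⟨ markov bad? (λ y → Q * length (star y S)) G′ <⇒≤ ⟩
          ∑ (λ y → Q * length (star y S)) G′           ≡⟨ ∑-*ˡ Q (λ y → length (star y S)) G′ ⟩
          Q * ∑ (λ y → length (star y S)) G′           ≡⟨ cong (Q *_) (∑-star uS) ⟩
          Q * (length S * k′)                          ≤⟨ *-monoʳ-≤ Q (*-monoˡ-≤ k′ (star-crude x∈)) ⟩
          Q * (c * w * k′)                             ≡⟨ solve 4 (λ Q c w k → Q :* (c :* w :* k) := Q :* k :* c :* w) refl Q c w k′ ⟩
          Q * k′ * c * w                               ∎)
          where open +-*-Solver

        -- At most `suc (Q * k′ * c)` points are to be avoided, each lying in at most `c * w`
        -- members; `K` is the product of the two constants.
        ∃-generic : ∃[ a ] (a ∈ˡ 𝒜 × (∀ {y} → y ∈ˡ (x ∷ bad) → ¬ y ∈ a))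
        ∃-generic = ∃-avoiding _∈?_ 𝒜 (x ∷ bad) (begin-strict
          ∑ (λ y → length (star y 𝒜)) (x ∷ bad)        ≤⟨ ∑-≤ (λ y → length (star y 𝒜)) (x ∷ bad) (star-crude ∘ ∈G) ⟩
          suc (length bad) * (c * w)                   ≤⟨ *-monoˡ-≤ (c * w) (s≤s few-bad) ⟩
          suc (Q * k′ * c) * (c * w)                   ≡⟨ *-assoc (suc (Q * k′ * c)) c w ⟨
          K * w                                        <⟨ large ⟩
          length 𝒜                                     ∎)
          where
          ∈G : ∀ {y} → y ∈ˡ (x ∷ bad) → y ∈ˡ G
          ∈G (here refl) = x∈
          ∈G (there y∈) = ∈-─⁻ x∈ (proj₁ (∈-filter⁻ bad? y∈))

        -- Split the star by whether a member meets the generic `a` in `G′`. Those that do are few,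
        -- as no point of `a` is bad; the others contain no chain of length `suc t`, so the
        -- induction hypothesis bounds them by `p`.
        star-fine : Q * length S ≤ Q * p + k * w
        star-fine with a , a∈ , avoids ← ∃-generic = begin
          Q * length S                                 ≡⟨ cong (Q *_) (trans (count-split (meets? _∈?_ L) S) (+-comm (count (meets? _∈?_ L) S) _)) ⟩
          Q * (length ℬ + count (meets? _∈?_ L) S)     ≡⟨ *-distribˡ-+ Q (length ℬ) _ ⟩
          Q * length ℬ + Q * count (meets? _∈?_ L) S   ≤⟨ +-mono-≤ (*-monoʳ-≤ Q |ℬ|≤p) meets≤ ⟩
          Q * p + k * w                                ∎
          where
          L = filter (_∈? a) G′
          ℬ = filter (¬? ∘ meets? _∈?_ L) S

          meets≤ : Q * count (meets? _∈?_ L) S ≤ k * w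
          meets≤ = begin
            Q * count (meets? _∈?_ L) S                ≤⟨ *-monoʳ-≤ Q (count-meets _∈?_ S L) ⟩
            Q * ∑ (λ y → length (star y S)) L          ≡⟨ ∑-*ˡ Q (λ y → length (star y S)) L ⟨
            ∑ (λ y → Q * length (star y S)) L          ≤⟨ ∑-≤ (λ y → Q * length (star y S)) L good ⟩
            length L * w                               ≤⟨ *-monoˡ-≤ w (≤-trans (count-─-≤ (_∈? a) x∈) (≤-reflexive (degree u a∈))) ⟩
            k * w                                      ∎
            where
            good : ∀ {y} → y ∈ˡ L → Q * length (star y S) ≤ w
            good y∈ with y∈G′ , y∈a ← ∈-filter⁻ (_∈? a) {xs = G′} y∈ =
              ≮⇒≥ (λ lt → avoids (there (∈-filter⁺ bad? y∈G′ lt)) y∈a)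

          |ℬ|≤p : length ℬ ≤ p
          -- A chain point lies in `G′` and in a member of `ℬ`, hence not in `a`, whose points in
          -- `G′` make up `L`. So the chain extends downwards by `a` and `x`.
          |ℬ|≤p = Bound-t {P = _∈ˡ G′} (uniform-filter (¬? ∘ meets? _∈?_ L) uS) (length-G─ x∈) id
            (λ ch → ¬ch (cons a∈ (avoids (here refl)) (G⊆P x∈)
              (chain-mono (proj₁ ∘ ∈-filter⁻ (¬? ∘ meets? _∈?_ L))
                (λ b∈ y∈b y∈G′ → G⊆P (∈-─⁻ x∈ y∈G′) ,
                  λ y∈a → proj₂ (∈-filter⁻ (¬? ∘ meets? _∈?_ L) {xs = S} b∈) (lose (∈-filter⁺ (_∈? a) y∈G′ y∈a) y∈b))
                ch)))

      M≡ : ((d + suc t) C suc t) * suc t ≡ suc (d + t) * p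
      M≡ = trans (cong (λ n → (n C suc t) * suc t) (+-suc d t)) ([1+n]C[1+k]*[1+k]≡[1+n]*nCk (d + t) t)

      -- A family with at most `K * w` members is below the bound because the binomial grows by a
      -- factor of order `d` from `t` to `suc t`. For a larger one the fine degree bounds are summed
      -- over all points.
      coreless-bound : k ≤ d → K * q * suc t ≤ d → length 𝒜 ≤ (d + suc t) C suc t
      coreless-bound k≤d Kqt≤d with length 𝒜 ≤? K * w
      ... | yes small = *-cancelʳ-≤ (length 𝒜) _ (suc t) (begin
        length 𝒜 * suc t                               ≤⟨ *-monoˡ-≤ (suc t) (≤-trans small (*-monoʳ-≤ K ([d+k]^t≤ d k t))) ⟩
        K * (q * p) * suc t                            ≡⟨ solve 4 (λ K q p t → K :* (q :* p) :* t := K :* q :* t :* p) refl K q p (suc t) ⟩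
        K * q * suc t * p                              ≤⟨ *-monoˡ-≤ p (≤-trans Kqt≤d (m≤n⇒m≤1+n (m≤m+n d t))) ⟩
        suc (d + t) * p                                ≡⟨ M≡ ⟨
        ((d + suc t) C suc t) * suc t                    ∎)
        where open +-*-Solver
      ... | no ¬small = slack d k t q (s≤s 1+t≤k′) k≤d ([d+k]^t≤ d k t) M≡ (begin
        Q * (length 𝒜 * k)                             ≡⟨ cong (Q *_) (∑-star u) ⟨
        Q * ∑ (λ x → length (star x 𝒜)) G              ≡⟨ ∑-*ˡ Q (λ x → length (star x 𝒜)) G ⟨
        ∑ (λ x → Q * length (star x 𝒜)) G              ≤⟨ ∑-≤ (λ x → Q * length (star x 𝒜)) G (star-fine (≰⇒> ¬small)) ⟩
        length G * (Q * p + k * w)                     ≡⟨ cong (_* (Q * p + k * w)) |G|≡m ⟩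
        m * (Q * p + k * w)                            ∎)

  -- The induction for the upper bound

  bound-─ : ∀ {k s d G 𝒜 x} {P : V → Set} → Bound k s d → (x∈ : x ∈ˡ G) → (∀ {a} → a ∈ˡ 𝒜 → x ∈ a) →
    Uniform (suc k) G 𝒜 → length G ≡ d + suc k → (∀ {x} → x ∈ˡ G → P x) → ¬ Chain P 𝒜 (suc s) →
    length 𝒜 ≤ (d + s) C s
  bound-─ {k} {d = d} bound x∈ x∈all u |G|≡ G⊆P = bound (uniform-─ x∈ x∈all u)
    (suc-injective (trans (sym (length-─ x∈)) (trans |G|≡ (+-suc d k)))) (G⊆P ∘ ∈-─⁻ x∈)

  upper-bound : ∀ k s {d} → s ≤ k → threshold k s ≤ d → Bound k s d
  upper-bound zero zero _ _ {G} u _ _ _ = uniform-length G u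
  upper-bound (suc k) s s≤1+k d₀≤d {G} u |G|≡ G⊆P ¬ch with s ≤? k
  ... | no s≰k with refl ← ≤-antisym s≤1+k (≰⇒> s≰k) = subst (λ n → _ ≤ n C suc k) |G|≡ (uniform-length G u)
  upper-bound (suc k) zero _ _ {G} {𝒜} u |G|≡ G⊆P ¬ch | yes s≤k with core? G 𝒜
  ... | inj₁ (x , x∈ , x∈all) = bound-─ (upper-bound k 0 z≤n (0≤ k)) x∈ x∈all u |G|≡ G⊆P ¬ch
    where
    0≤ : ∀ k {d} → threshold k 0 ≤ d
    0≤ zero = z≤n
    0≤ (suc _) = z≤n
  -- A member through `x` and a member avoiding `x` form a chain of length 1, so all stars are
  -- empty; as members have `suc k` points, the family is empty too.
  ... | inj₂ coreless = begin
    length 𝒜                              ≤⟨ m≤m*n (length 𝒜) (suc k) ⟩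
    length 𝒜 * suc k                      ≡⟨ ∑-star u ⟨
    ∑ (λ x → length (star x 𝒜)) G         ≤⟨ ∑-≤ (λ x → length (star x 𝒜)) G (λ x∈ → let (a , a∈ , x∉a) = coreless x∈ in
                                               ≤-reflexive (chainless-zero (λ ch → ¬ch (cons a∈ x∉a (G⊆P x∈) ch)))) ⟩
    length G * 0                          ≡⟨ *-zeroʳ (length G) ⟩
    0                                     ≤⟨ z≤n ⟩
    1                                     ∎
    where open ≤-Reasoning
  upper-bound (suc k) (suc t) {d} _ d₀≤d {G} {𝒜} u |G|≡ G⊆P ¬ch | yes s≤k with core? G 𝒜
  ... | inj₁ (x , x∈ , x∈all) = bound-─ (upper-bound k (suc t) s≤k (m+n≤o⇒m≤o _ d₀≤d)) x∈ x∈all u |G|≡ G⊆P ¬ch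
  ... | inj₂ coreless = Stability.coreless-bound t k d s≤k
      (upper-bound k t (≤-trans (n≤1+n t) s≤k) (m+n≤o⇒m≤o _ rest≤d)) u |G|≡ G⊆P ¬ch coreless
      (m+n≤o⇒m≤o _ k+≤d) (m+n≤o⇒n≤o (suc k) k+≤d)
    where
    rest≤d = m+n≤o⇒n≤o (threshold k (suc t)) d₀≤d
    k+≤d = m+n≤o⇒n≤o (threshold k t) rest≤d

-- From chains of points to maximal chains in a trace

open Incidence using (Chain; nil; cons; Uniform; upper-bound)

∣p∣≡0⇒x∉p : ∀ {n} {p : Subset n} {x} → ∣ p ∣ ≡ 0 → x ∉ p
∣p∣≡0⇒x∉p {x = x} ∣p∣≡0 x∈p with () ← subst₂ _≤_ (∣⁅x⁆∣≡1 x) ∣p∣≡0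
  (p⊆q⇒∣p∣≤∣q∣ (λ y∈ → subst (_∈ _) (sym (x∈⁅y⁆⇒x≡y x y∈)) x∈p))

x∉p⇒∣p∪⁅x⁆∣≡1+∣p∣ : ∀ {n} (p : Subset n) x → x ∉ p → ∣ p ∪ ⁅ x ⁆ ∣ ≡ suc ∣ p ∣
x∉p⇒∣p∪⁅x⁆∣≡1+∣p∣ (inside ∷ p) fzero x∉p = contradiction here x∉p
x∉p⇒∣p∪⁅x⁆∣≡1+∣p∣ (outside ∷ p) fzero x∉p = cong (suc ∘ ∣_∣) (∪-identityʳ p)
x∉p⇒∣p∪⁅x⁆∣≡1+∣p∣ (inside ∷ p) (fsuc x) x∉p = cong suc (x∉p⇒∣p∪⁅x⁆∣≡1+∣p∣ p x (x∉p ∘ there))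
x∉p⇒∣p∪⁅x⁆∣≡1+∣p∣ (outside ∷ p) (fsuc x) x∉p = x∉p⇒∣p∪⁅x⁆∣≡1+∣p∣ p x (x∉p ∘ there)

x∈p⇒p∩⁅x⁆≡⁅x⁆ : ∀ {n} {p : Subset n} {x} → x ∈ p → p ∩ ⁅ x ⁆ ≡ ⁅ x ⁆
x∈p⇒p∩⁅x⁆≡⁅x⁆ {p = p} {x} x∈p = ⊆-antisym (p∩q⊆q p ⁅ x ⁆)
  (λ y∈ → x∈p∩q⁺ (subst (_∈ p) (sym (x∈⁅y⁆⇒x≡y x y∈)) x∈p , y∈))

-- The first member has empty trace, and adding `x` to the traces of the later members on `X′` gives
-- the rest of the chain. The inclusion of `X` in `P` is carried along because inside the star it
-- says that `X′` is disjoint from `a`.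
chain⇒maximalChain : ∀ {n r} {P : Fin n → Set} {𝒜 : Family n} → Chain _∈?_ P 𝒜 r →
  ∃[ X ] ((∀ {y} → y ∈ X → P y) × TraceHasMaxChain 𝒜 r X)
chain⇒maximalChain {n} {𝒜 = 𝒜} (nil {a} a∈) = ⊥ , (λ y∈ → contradiction y∈ ∉⊥) , 𝒞 , trace
  where
  𝒞 : MaximalChain 0 ⊥
  𝒞 = record { chain = λ _ → ⊥ ; size = λ { fzero → ∣⊥∣≡0 n } ; incl = λ () ; top = refl }
  trace : ∀ i → InTrace 𝒜 ⊥ (MaximalChain.chain 𝒞 i)
  trace _ = a , a∈ , ∩-zeroʳ a
chain⇒maximalChain {n} {suc r} {P} {𝒜} (cons {a} {x} a∈ x∉a px ch) with chain⇒maximalChain ch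
... | X′ , X′⊆ , 𝒞′ , trace′ = X , X⊆P , 𝒞 , trace
  where
  open MaximalChain 𝒞′ renaming (chain to chain′; size to size′; incl to incl′; top to top′)

  X = X′ ∪ ⁅ x ⁆

  X⊆P : ∀ {y} → y ∈ X → P y
  X⊆P y∈ with x∈p∪q⁻ X′ ⁅ x ⁆ y∈
  ... | inj₁ y∈X′ = proj₁ (X′⊆ y∈X′)
  ... | inj₂ y∈x with refl ← x∈⁅y⁆⇒x≡y x y∈x = px

  -- The least set of the smaller chain is empty, and it is the trace of a member through `x`.
  x∉X′ : x ∉ X′
  x∉X′ x∈X′ with b , b∈ , b∩X′≡ ← trace′ fzero =
    ∣p∣≡0⇒x∉p (size′ fzero) (subst (x ∈_) b∩X′≡ (x∈p∩q⁺ (proj₂ (∈-filter⁻ (x ∈?_) {xs = 𝒜} b∈) , x∈X′)))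

  x∉chain′ : ∀ i → x ∉ chain′ i
  x∉chain′ i x∈ with b , b∈ , b∩X′≡ ← trace′ i =
    x∉X′ (proj₂ (x∈p∩q⁻ b X′ (subst (x ∈_) (sym b∩X′≡) x∈)))

  extended : Fin (suc (suc r)) → Subset n
  extended fzero    = ⊥
  extended (fsuc i) = chain′ i ∪ ⁅ x ⁆

  size″ : ∀ i → ∣ extended i ∣ ≡ toℕ i
  size″ fzero    = ∣⊥∣≡0 n
  size″ (fsuc i) = trans (x∉p⇒∣p∪⁅x⁆∣≡1+∣p∣ (chain′ i) x (x∉chain′ i)) (cong suc (size′ i))

  incl″ : ∀ (i : Fin (suc r)) → extended (inject₁ i) ⊆ extended (fsuc i)
  incl″ fzero    = ⊥⊆
  incl″ (fsuc i) y∈ with x∈p∪q⁻ (chain′ (inject₁ i)) ⁅ x ⁆ y∈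
  ... | inj₁ y∈chain = x∈p∪q⁺ (inj₁ (incl′ i y∈chain))
  ... | inj₂ y∈x     = x∈p∪q⁺ (inj₂ y∈x)

  𝒞 : MaximalChain (suc r) X
  𝒞 = record { chain = extended ; size = size″ ; incl = incl″ ; top = cong (_∪ ⁅ x ⁆) top′ }

  trace : ∀ i → InTrace 𝒜 X (extended i)
  trace fzero = a , a∈ , Empty-unique (λ (y , y∈) → disjoint (x∈p∩q⁻ a X y∈))
    where
    disjoint : ∀ {y} → ¬ (y ∈ a × y ∈ X)
    disjoint (y∈a , y∈X) with x∈p∪q⁻ X′ ⁅ x ⁆ y∈X
    ... | inj₁ y∈X′ = proj₂ (X′⊆ y∈X′) y∈a
    ... | inj₂ y∈x with refl ← x∈⁅y⁆⇒x≡y x y∈x = x∉a y∈a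
  trace (fsuc i) with b , b∈ , b∩X′≡ ← trace′ i with b∈𝒜 , x∈b ← ∈-filter⁻ (x ∈?_) b∈ =
    b , b∈𝒜 , trans (∩-distribˡ-∪ b X′ ⁅ x ⁆) (cong₂ _∪_ b∩X′≡ (x∈p⇒p∩⁅x⁆≡⁅x⁆ x∈b))

admissible⇒chainless : ∀ {n k r} {P : Fin n → Set} {𝒜 : Family n} → Admissible n k r 𝒜 → ¬ Chain _∈?_ P 𝒜 r
admissible⇒chainless {r = r} (_ , noChain) ch with X , _ , tr@(𝒞 , _) ← chain⇒maximalChain ch =
  noChain X (trans (cong ∣_∣ (sym top)) (trans (size (fromℕ r)) (toℕ-fromℕ r))) tr
  where open MaximalChain 𝒞

count-allFin : ∀ {n} (p : Subset n) → count (_∈? p) (allFin n) ≡ ∣ p ∣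
count-allFin p = count-tabulate p p id id id
  where
  -- An arbitrary `f` is allowed because the tail of `allFin` is tabulated by `fsuc`.
  count-tabulate : ∀ {m n} (p : Subset m) (q : Subset n) (f : Fin m → Fin n) →
    (∀ {x} → x ∈ p → f x ∈ q) → (∀ {x} → f x ∈ q → x ∈ p) → count (_∈? q) (tabulate f) ≡ ∣ p ∣
  count-tabulate [] q f p⇒q q⇒p = refl
  count-tabulate (inside ∷ p) q f p⇒q q⇒p with f fzero ∈? q
  ... | yes _ = cong suc (count-tabulate p q (f ∘ fsuc) (p⇒q ∘ there) (drop-there ∘ q⇒p))
  ... | no ∉q = contradiction (p⇒q here) ∉q
  count-tabulate (outside ∷ p) q f p⇒q q⇒p with f fzero ∈? q
  ... | yes ∈q with () ← q⇒p ∈q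
  ... | no _ = count-tabulate p q (f ∘ fsuc) (p⇒q ∘ there) (drop-there ∘ q⇒p)

kFamily⇒uniform : ∀ {n k} {𝒜 : Family n} → IsKFamily k 𝒜 → Uniform _∈?_ k (allFin n) 𝒜
kFamily⇒uniform (uniq , sizes) = record
  { unique    = uniq
  ; degree    = λ {a} a∈ → trans (count-allFin a) (All.lookup sizes a∈)
  ; separated = λ _ _ a⊆b b⊆a → ⊆-antisym (a⊆b (∈-allFin _)) (b⊆a (∈-allFin _))
  }

-- The extremal family

kSubsets : ∀ n → ℕ → Family n
kSubsets zero    zero    = [] ∷ []
kSubsets zero    (suc k) = []
kSubsets (suc n) zero    = map (outside ∷_) (kSubsets n zero)
kSubsets (suc n) (suc k) = map (inside ∷_) (kSubsets n k) ++ map (outside ∷_) (kSubsets n (suc k))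

length-kSubsets : ∀ n k → length (kSubsets n k) ≡ n C k
length-kSubsets zero    zero    = refl
length-kSubsets zero    (suc k) = refl
length-kSubsets (suc n) zero    = trans (length-map _ (kSubsets n zero)) (length-kSubsets n zero)
length-kSubsets (suc n) (suc k) = trans (length-++ (map (inside ∷_) (kSubsets n k)))
  (trans (cong₂ _+_ (trans (length-map _ (kSubsets n k)) (length-kSubsets n k))
                    (trans (length-map _ (kSubsets n (suc k))) (length-kSubsets n (suc k))))
         (nCk+nC[k+1]≡[n+1]C[k+1] n k))

kSubsets-unique : ∀ n k → Unique (kSubsets n k)
kSubsets-unique zero    zero    = [] ∷ []
kSubsets-unique zero    (suc k) = []
kSubsets-unique (suc n) zero    = Unique.map⁺ ∷-injectiveʳ (kSubsets-unique n zero)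
kSubsets-unique (suc n) (suc k) = Unique.++⁺ (Unique.map⁺ ∷-injectiveʳ (kSubsets-unique n k))
  (Unique.map⁺ ∷-injectiveʳ (kSubsets-unique n (suc k))) heads-differ
  where
  heads-differ : ∀ {A} → ¬ (A ∈ˡ map (inside ∷_) (kSubsets n k) × A ∈ˡ map (outside ∷_) (kSubsets n (suc k)))
  heads-differ (in∈ , out∈) with _ , _ , refl ← ∈-map⁻ (inside ∷_) in∈ with _ , _ , () ← ∈-map⁻ (outside ∷_) out∈

kSubsets-size : ∀ n k → All (λ A → ∣ A ∣ ≡ k) (kSubsets n k)
kSubsets-size zero    zero    = refl ∷ []
kSubsets-size zero    (suc k) = []
kSubsets-size (suc n) zero    = All.map⁺ (kSubsets-size n zero)
kSubsets-size (suc n) (suc k) = All.++⁺ (All.map⁺ (All.map (cong suc) (kSubsets-size n k))) (All.map⁺ (kSubsets-size n (suc k)))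

-- The first `j` points play the role of the fixed set F.
full++ : ∀ j {N} → Subset N → Subset (j + N)
full++ j A = replicate j inside ++ᵛ A

∣full++∣ : ∀ j {N} (A : Subset N) → ∣ full++ j A ∣ ≡ j + ∣ A ∣
∣full++∣ zero    A = refl
∣full++∣ (suc j) A = cong suc (∣full++∣ j A)

-- A point of `X` among the first `j` would lie in the first trace, which is empty. So `X` lives on
-- the last `N` points, where the second member is `B`.
full-trace-size : ∀ j {N} (X : Subset (j + N)) (A B : Subset N) →
  ∣ full++ j A ∩ X ∣ ≡ 0 → full++ j B ∩ X ≡ X → ∣ X ∣ ≤ ∣ B ∣
full-trace-size zero    X A B _ B∩X≡X = subst (λ Y → ∣ Y ∣ ≤ ∣ B ∣) B∩X≡X (∣p∩q∣≤∣p∣ B X)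
full-trace-size (suc j) (outside ∷ X) A B A∩X B∩X≡X = full-trace-size j X A B A∩X (∷-injectiveʳ B∩X≡X)

lower-bound : ∀ j N s → ∃[ 𝒜 ] (Admissible (j + N) (j + s) (suc s) 𝒜 × length 𝒜 ≡ N C s)
lower-bound j N s = 𝒜 , ((uniq , sizes) , noChain) , trans (length-map (full++ j) (kSubsets N s)) (length-kSubsets N s)
  where
  𝒜 = map (full++ j) (kSubsets N s)

  uniq : Unique 𝒜
  uniq = Unique.map⁺ (++-injectiveʳ (replicate j inside) (replicate j inside)) (kSubsets-unique N s)

  sizes : All (λ A → ∣ A ∣ ≡ j + s) 𝒜
  sizes = All.map⁺ (All.map (λ {A} ∣A∣≡s → trans (∣full++∣ j A) (cong (j +_) ∣A∣≡s)) (kSubsets-size N s))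

  noChain : ∀ X → ∣ X ∣ ≡ suc s → ¬ TraceHasMaxChain 𝒜 (suc s) X
  noChain X ∣X∣≡1+s (𝒞 , trace)
    -- The lowest set of the chain is empty and the highest is `X` itself, so `suc s` would be at
    -- most `s`.
    with A , A∈ , A∩X≡ ← trace fzero | B , B∈ , B∩X≡ ← trace (fromℕ (suc s))
    with A₀ , _ , refl ← ∈-map⁻ (full++ j) A∈ | B₀ , B₀∈ , refl ← ∈-map⁻ (full++ j) B∈ =
    1+n≰n (subst₂ _≤_ ∣X∣≡1+s (All.lookup (kSubsets-size N s) B₀∈)
      (full-trace-size j X A₀ B₀ (trans (cong ∣_∣ A∩X≡) (size fzero)) (trans B∩X≡ top)))
    where open MaximalChain 𝒞

-- Both bounds combined

theorem2 : ∀ (r k : ℕ) → 1 ≤ r → r ∸ 1 ≤ k →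
    ∃[ n₀ ] (∀ (n : ℕ) → n₀ ≤ n → IsW n k r ((n ∸ k + r ∸ 1) C (r ∸ 1)))
theorem2 (suc s) k _ s≤k = d₀ + k , isW
  where
  d₀ = threshold k s

  isW : ∀ n → d₀ + k ≤ n → IsW n k (suc s) ((n ∸ k + suc s ∸ 1) C s)
  isW n n₀≤n = subst (λ N → IsW n k (suc s) (N C s)) (sym (cong (_∸ 1) (+-suc (n ∸ k) s))) (lower , upper)
    where
    d = n ∸ k
    n≡ : n ≡ d + k
    n≡ = sym (m∸n+n≡m (m+n≤o⇒n≤o d₀ n₀≤n))

    lower : ∃[ 𝒜 ] (Admissible n k (suc s) 𝒜 × length 𝒜 ≡ (d + s) C s)
    -- Fixing `k ∸ s` of the n points leaves `d + s` free ones, of which each member takes `s`.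
    lower = subst₂ (λ n k → ∃[ 𝒜 ] (Admissible n k (suc s) 𝒜 × length 𝒜 ≡ (d + s) C s))
      (begin
        k ∸ s + (d + s)     ≡⟨ cong (k ∸ s +_) (+-comm d s) ⟩
        k ∸ s + (s + d)     ≡⟨ +-assoc (k ∸ s) s d ⟨
        k ∸ s + s + d       ≡⟨ cong (_+ d) (m∸n+n≡m s≤k) ⟩
        k + d               ≡⟨ +-comm k d ⟩
        d + k               ≡⟨ n≡ ⟨
        n                   ∎)
      (m∸n+n≡m s≤k) (lower-bound (k ∸ s) (d + s) s)
      where open ≡-Reasoning

    upper : ∀ 𝒜 → Admissible n k (suc s) 𝒜 → length 𝒜 ≤ (d + s) C s
    upper 𝒜 adm@(fam , _) = upper-bound _∈?_ k s s≤k (m+n≤o⇒m≤o∸n d₀ n₀≤n) (kFamily⇒uniform fam)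
      (trans (length-tabulate id) n≡) (λ _ → tt) (admissible⇒chainless adm)
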